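{- Let $S$ be a finite partially ordered set that contains a $0$ element (a least element), and let $R=R(S)$ be the Redheffer matrix of $S$. Then the permanent of $R$ is the number of chains of $S$ that contain the $0$ element, and $$\det R=\sum_{x\in S}\mu(0,x),$$ where $\mu$ is the Möbius function of $S$.
   Context: Let $(S,\preceq)$ be a finite poset with a least element $0$ (so $0\preceq x$ for all $x\in S$). Suppose the elements of $S$ are labeled by the positive integers $1,\dots,|S|$ in such a way that the $\zeta$-matrix of $S$ (whose $(x,y)$ entry is $1$ if $x\preceq y$ and $0$ otherwise) is upper-triangular; in particular $0$ is labeled first. The Redheffer matrix $R(S)$ is the result of replacing the first column of the $\zeta$-matrix (the column labeled by the $0$ element) by a column of all $1$'s. That is, $R(S)_{x,y}=1$ if $x\preceq y$ or $y=0$, and $R(S)_{x,y}=0$ otherwise. A chain of $S$ is a totally ordered subset of $S$; the one-element chain $\{0\}$ is counted among the chains containing $0$. The Möbius function $\mu$ of $S$ is given by the entries of the inverse of the $\zeta$-matrix: $\mu(x,y)=(\zeta^{ -1})_{x,y}$. The permanent of a square matrix $A$ indexed by $S$ is $\sum_\sigma\prod_{x\in S}A_{x,\sigma(x)}$, over all permutations $\sigma$ of $S$. -}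

module Defs where

open import Data.Bool.Base using (if_then_else_)
open import Data.Fin.Base as Fin using (Fin; zero; suc)
open import Data.Fin.Permutation as Perm using (Permutation′; _⟨$⟩ʳ_; insert; insert-punchIn; insert-remove; remove)
import Data.Fin.Properties as Fin
open import Data.Fin.Subset using (Subset; _∈_; inside; outside)
open import Data.Fin.Subset.Properties using (_∈?_)
open import Data.Integer.Base using (ℤ; 0ℤ; 1ℤ; -1ℤ; _+_; _*_; -_; _^_)
open import Data.Integer.Properties
  using (+-*-semiring; *-1-commutativeMonoid; +-identityˡ; +-identityʳ; +-inverseˡ; +-inverseʳ;
         *-identityˡ; *-identityʳ; *-zeroˡ; *-zeroʳ; *-assoc; -1*i≡-i)
open import Data.List.Base using (List; []; _∷_; _++_; map; foldr; filter; length; allFin; cartesianProductWith; cartesianProduct)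
open import Data.List.Membership.Propositional.Properties using (∈-allFin)
open import Data.List.Relation.Unary.All using ([])
open import Data.List.Relation.Unary.AllPairs using ([]; _∷_)
open import Data.List.Relation.Unary.Any as Any using (Any; here)
import Data.List.Relation.Unary.Any.Properties as Any
open import Data.List.Relation.Unary.Unique.Propositional.Properties using (allFin⁺)
import Data.List.Relation.Unary.Unique.Setoid as Unique
import Data.List.Relation.Unary.Unique.Setoid.Properties as Unique
open import Data.Nat.Base using (ℕ; zero; suc; z<s; s<s)
open import Data.Product.Base using (∃; _×_; _,_; proj₁)
open import Data.Sum.Base using (_⊎_)
open import Data.Vec.Base using ([]; _∷_)
open import Function.Base using (_∘_)
open import Function.Bundles using (Inverse)
open import Level using (Level; 0ℓ)
open import Relation.Binary.Bundles using (Setoid; DecPoset)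
open import Relation.Binary.PropositionalEquality
open import Relation.Nullary.Decidable using (Dec; does; dec-true; _×-dec_; _⊎-dec_; _→-dec_)

open import Algebra.Properties.Semiring.Sum +-*-semiring public
  using (sum; sum-syntax; sum-cong-≗; sum-replicate-zero; ∑-comm; *-distribˡ-sum; *-distribʳ-sum)
open import Algebra.Properties.CommutativeMonoid.Sum *-1-commutativeMonoid public
  using () renaming (sum to product)

private
  variable
    p : Level
    n : ℕ

𝟙 : {P : Set p} → Dec P → ℤ
𝟙 d = if does d then 1ℤ else 0ℤ

-- A permutation of Fin (suc n) is determined by the image j of 0 and by the
-- permutation of Fin n left after deleting 0 and j.
permutations : ∀ n → List (Permutation′ n)
permutations zero    = Perm.id ∷ []
permutations (suc n) = cartesianProductWith (insert zero) (allFin (suc n)) (permutations n)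

inversions : Permutation′ n → List (Fin n × Fin n)
inversions {n} σ = filter
  (λ (i , j) → (i Fin.<? j) ×-dec ((σ ⟨$⟩ʳ j) Fin.<? (σ ⟨$⟩ʳ i)))
  (cartesianProduct (allFin n) (allFin n))

sign : Permutation′ n → ℤ
sign σ = -1ℤ ^ length (inversions σ)

sumPermutations : ∀ n → (Permutation′ n → ℤ) → ℤ
sumPermutations n f = foldr _+_ 0ℤ (map f (permutations n))

-- The list is complete and repetition-free, for pointwise equality.
permutations-complete : (π : Permutation′ n) → Any (π Perm.≈_) (permutations n)
permutations-complete {zero}  π = here λ ()
permutations-complete {suc n} π = Any.cartesianProductWith⁺ (insert zero) glue
  (∈-allFin (π ⟨$⟩ʳ zero)) (permutations-complete (remove zero π))
  where
  glue : ∀ {j ρ} → π ⟨$⟩ʳ zero ≡ j → remove zero π Perm.≈ ρ → π Perm.≈ insert zero j ρ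
  glue refl eq zero    = refl
  glue {j} {ρ} refl eq (suc k) = begin
    π ⟨$⟩ʳ suc k                                ≡⟨ insert-remove zero π (suc k) ⟨
    insert zero j (remove zero π) ⟨$⟩ʳ suc k    ≡⟨ insert-punchIn zero j (remove zero π) k ⟩
    Fin.punchIn j (remove zero π ⟨$⟩ʳ k)        ≡⟨ cong (Fin.punchIn j) (eq k) ⟩
    Fin.punchIn j (ρ ⟨$⟩ʳ k)                    ≡⟨ insert-punchIn zero j ρ k ⟨
    insert zero j ρ ⟨$⟩ʳ suc k                  ∎
    where open ≡-Reasoning

permutationSetoid : ℕ → Setoid 0ℓ 0ℓ
permutationSetoid n = record
  { Carrier       = Permutation′ n
  ; _≈_           = Perm._≈_
  ; isEquivalence = record
    { refl  = λ _ → refl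
    ; sym   = λ eq i → sym (eq i)
    ; trans = λ eq₁ eq₂ i → trans (eq₁ i) (eq₂ i)
    }
  }

permutations-unique : ∀ n → Unique.Unique (permutationSetoid n) (permutations n)
permutations-unique zero    = [] ∷ []
permutations-unique (suc n) = Unique.cartesianProductWith⁺
  (setoid (Fin (suc n))) (permutationSetoid n) (permutationSetoid (suc n))
  (insert zero) unglue (allFin⁺ (suc n)) (permutations-unique n)
  where
  unglue : ∀ {j k} {π ρ : Permutation′ n} →
           insert zero j π Perm.≈ insert zero k ρ → j ≡ k × π Perm.≈ ρ
  unglue eq with refl ← eq zero = refl , λ i → Fin.punchIn-injective _ _ _ (eq (suc i))

Matrix : ℕ → Set
Matrix n = Fin n → Fin n → ℤ

per : Matrix n → ℤ
per {n} A = sumPermutations n λ σ → product λ i → A i (σ ⟨$⟩ʳ i)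

det : Matrix n → ℤ
det {n} A = sumPermutations n λ σ → sign σ * product λ i → A i (σ ⟨$⟩ʳ i)

Id : Matrix n
Id i j = 𝟙 (i Fin.≟ j)

infixl 7 _⊗_
_⊗_ : Matrix n → Matrix n → Matrix n
_⊗_ {n} A B i j = ∑[ k < n ] (A i k * B k j)

IsInverse : Matrix n → Matrix n → Set
IsInverse A B = (∀ i j → (A ⊗ B) i j ≡ Id i j) × (∀ i j → (B ⊗ A) i j ≡ Id i j)

Invertible : Matrix n → Set
Invertible A = ∃ (IsInverse A)

UpperTriangular : Matrix n → Set
UpperTriangular A = ∀ {i j} → j Fin.< i → A i j ≡ 0ℤ

unitriangular⇒invertible : (A : Matrix n) → UpperTriangular A → (∀ i → A i i ≡ 1ℤ) → Invertible A
unitriangular⇒invertible {zero}  A _  _    = A , (λ ()) , (λ ())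
unitriangular⇒invertible {suc n} A ut diag
  with unitriangular⇒invertible (λ i j → A (suc i) (suc j)) (ut ∘ s<s) (diag ∘ suc)
... | B , AB , BA = X , AX , XA
  where
  open ≡-Reasoning

  r : Fin n → ℤ
  r k = A zero (suc k)

  rB : Fin n → ℤ
  rB j = ∑[ k < n ] (r k * B k j)

  X : Matrix (suc n)
  X zero    zero    = 1ℤ
  X zero    (suc j) = - rB j
  X (suc i) zero    = 0ℤ
  X (suc i) (suc j) = B i j

  sum-zero : {f : Fin n → ℤ} → (∀ k → f k ≡ 0ℤ) → sum f ≡ 0ℤ
  sum-zero eq = trans (sum-cong-≗ eq) (sum-replicate-zero n)

  sum-Id : ∀ {m} (f : Fin m → ℤ) j → ∑[ k < m ] (f k * Id k j) ≡ f j
  sum-Id {suc m} f zero = begin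
    f zero * 1ℤ + ∑[ k < m ] (f (suc k) * 0ℤ)
      ≡⟨ cong₂ _+_ (*-identityʳ (f zero))
           (trans (sum-cong-≗ (λ k → *-zeroʳ (f (suc k)))) (sum-replicate-zero m)) ⟩
    f zero + 0ℤ  ≡⟨ +-identityʳ (f zero) ⟩
    f zero       ∎
  sum-Id {suc m} f (suc j) = begin
    f zero * 0ℤ + ∑[ k < m ] (f (suc k) * Id k j)
      ≡⟨ cong₂ _+_ (*-zeroʳ (f zero)) (sum-Id (f ∘ suc) j) ⟩
    0ℤ + f (suc j)  ≡⟨ +-identityˡ (f (suc j)) ⟩
    f (suc j)       ∎

  rBA : ∀ j → ∑[ k < n ] (rB k * A (suc k) (suc j)) ≡ r j
  rBA j = begin
    ∑[ k < n ] (rB k * A (suc k) (suc j))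
      ≡⟨ sum-cong-≗ (λ k → *-distribʳ-sum (A (suc k) (suc j)) (λ l → r l * B l k)) ⟩
    ∑[ k < n ] ∑[ l < n ] (r l * B l k * A (suc k) (suc j))
      ≡⟨ ∑-comm (λ k l → r l * B l k * A (suc k) (suc j)) ⟩
    ∑[ l < n ] ∑[ k < n ] (r l * B l k * A (suc k) (suc j))
      ≡⟨ sum-cong-≗ (λ l → trans
           (sum-cong-≗ (λ k → *-assoc (r l) (B l k) (A (suc k) (suc j))))
           (sym (*-distribˡ-sum (r l) (λ k → B l k * A (suc k) (suc j))))) ⟩
    ∑[ l < n ] (r l * ∑[ k < n ] (B l k * A (suc k) (suc j)))
      ≡⟨ sum-cong-≗ (λ l → cong (r l *_) (BA l j)) ⟩
    ∑[ l < n ] (r l * Id l j)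
      ≡⟨ sum-Id r j ⟩
    r j ∎

  AX : ∀ i j → (A ⊗ X) i j ≡ Id i j
  AX zero zero = cong₂ _+_ (cong (_* 1ℤ) (diag zero)) (sum-zero (λ k → *-zeroʳ (r k)))
  AX zero (suc j) = begin
    A zero zero * - rB j + rB j  ≡⟨ cong (λ a → a * - rB j + rB j) (diag zero) ⟩
    1ℤ * - rB j + rB j           ≡⟨ cong (_+ rB j) (*-identityˡ (- rB j)) ⟩
    - rB j + rB j                ≡⟨ +-inverseˡ (rB j) ⟩
    0ℤ                           ∎
  AX (suc i) zero =
    cong₂ _+_ (cong (_* 1ℤ) (ut z<s)) (sum-zero (λ k → *-zeroʳ (A (suc i) (suc k))))
  AX (suc i) (suc j) = begin
    A (suc i) zero * - rB j + ∑[ k < n ] (A (suc i) (suc k) * B k j)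
      ≡⟨ cong₂ _+_ (cong (_* - rB j) (ut z<s)) (AB i j) ⟩
    0ℤ * - rB j + Id i j  ≡⟨ cong (_+ Id i j) (*-zeroˡ (- rB j)) ⟩
    0ℤ + Id i j           ≡⟨ +-identityˡ (Id i j) ⟩
    Id i j                ∎

  XA : ∀ i j → (X ⊗ A) i j ≡ Id i j
  XA zero zero = cong₂ _+_ (cong (1ℤ *_) (diag zero))
    (sum-zero (λ k → trans (cong (- rB k *_) (ut z<s)) (*-zeroʳ (- rB k))))
  XA zero (suc j) = begin
    1ℤ * r j + ∑[ k < n ] (- rB k * A (suc k) (suc j))
      ≡⟨ cong₂ _+_ (*-identityˡ (r j)) (sum-cong-≗ (λ k → neg (rB k) (A (suc k) (suc j)))) ⟩
    r j + ∑[ k < n ] (-1ℤ * (rB k * A (suc k) (suc j)))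
      ≡⟨ cong (r j +_) (*-distribˡ-sum -1ℤ (λ k → rB k * A (suc k) (suc j))) ⟨
    r j + -1ℤ * ∑[ k < n ] (rB k * A (suc k) (suc j))
      ≡⟨ cong (λ s → r j + -1ℤ * s) (rBA j) ⟩
    r j + -1ℤ * r j  ≡⟨ cong (r j +_) (-1*i≡-i (r j)) ⟩
    r j + - r j      ≡⟨ +-inverseʳ (r j) ⟩
    0ℤ               ∎
    where
    neg : ∀ x y → - x * y ≡ -1ℤ * (x * y)
    neg x y = trans (cong (_* y) (sym (-1*i≡-i x))) (*-assoc -1ℤ x y)
  XA (suc i) zero = cong₂ _+_ (*-zeroˡ (A zero zero))
    (sum-zero (λ k → trans (cong (B i k *_) (ut z<s)) (*-zeroʳ (B i k))))
  XA (suc i) (suc j) = trans (cong₂ _+_ (*-zeroˡ (r j)) (BA i j)) (+-identityˡ (Id i j))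

subsets : ∀ n → List (Subset n)
subsets zero    = [] ∷ []
subsets (suc n) = map (inside ∷_) (subsets n) ++ map (outside ∷_) (subsets n)

-- A bijection of the poset with its labels; it exhibits the poset as finite
-- with n elements.  The labels 1, …, n are represented by Fin n.
Labelling : ∀ {c ℓ₁ ℓ₂} → DecPoset c ℓ₁ ℓ₂ → ℕ → Set _
Labelling S n = Inverse (setoid (Fin n)) (DecPoset.Eq.setoid S)

module LabelledPoset {c ℓ₁ ℓ₂} (S : DecPoset c ℓ₁ ℓ₂) {n : ℕ} (labelling : Labelling S n) where

  open DecPoset S using (Carrier; _≤_; _≟_; _≤?_) renaming (refl to ≤-refl)

  element : Fin n → Carrier
  element = Inverse.to labelling

  label : Carrier → Fin n
  label = Inverse.from labelling

  ζ : Matrix n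
  ζ i j = 𝟙 (element i ≤? element j)

  ζ-diagonal : ∀ i → ζ i i ≡ 1ℤ
  ζ-diagonal i = cong (if_then 1ℤ else 0ℤ) (dec-true (element i ≤? element i) ≤-refl)

  ζ⁻¹ : UpperTriangular ζ → Matrix n
  ζ⁻¹ ut = proj₁ (unitriangular⇒invertible ζ ut ζ-diagonal)

  μ : UpperTriangular ζ → Carrier → Carrier → ℤ
  μ ut x y = ζ⁻¹ ut (label x) (label y)

  Redheffer : Carrier → Matrix n
  Redheffer 0# i j = 𝟙 ((element i ≤? element j) ⊎-dec (element j ≟ 0#))

  ∑S : (Carrier → ℤ) → ℤ
  ∑S f = ∑[ i < n ] f (element i)

  -- A subset of the poset is given by the set of labels of its elements.
  IsChain : Subset n → Set _
  IsChain C = ∀ i j → i ∈ C → j ∈ C → element i ≤ element j ⊎ element j ≤ element i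

  isChain? : ∀ C → Dec (IsChain C)
  isChain? C = Fin.all? λ i → Fin.all? λ j →
    (i ∈? C) →-dec ((j ∈? C) →-dec ((element i ≤? element j) ⊎-dec (element j ≤? element i)))

  chainsContaining : Carrier → List (Subset n)
  chainsContaining x = filter (λ C → isChain? C ×-dec (label x ∈? C)) (subsets n)

{-# OPTIONS --safe #-}

-- Let [1 r; 1 Z] be Z bordered by a column of ones and a first row (1, r); the
-- Redheffer matrix has this form, with r the row of 0 in ζ and Z the ζ-matrix of
-- the other elements.  Write r = (r₀, r′), let z be the first row of Z after the
-- diagonal and Z′ the rest.  Since Z is unitriangular, for ε = 1 (permanent) or
-- ε = -1 (determinant), Laplace expansion yields
--   L [1 r; 1 Z] = ε r₀ L [1 z; 1 Z′] + L [1 r′; 1 Z′].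
-- For ε = 1 and r the indicator of the elements above x, this is the recursion for
-- the number of chains above x, split by whether the first element is in the
-- chain.  For ε = -1 it is also satisfied by 1 - r·b, where b = Z⁻¹ 1 is the vector
-- of row sums of the Möbius matrix.
module Submission where

open import Data.Integer.Base using (+_)
open import Data.List.Base using (length)
open import Data.Nat.Base using (ℕ)
open import Data.Product.Base using (_×_)
open import Relation.Binary.Bundles using (DecPoset)
open import Relation.Binary.Definitions using (Minimum)
open import Relation.Binary.PropositionalEquality using (_≡_)
open import Defs
open LabelledPoset

import Algebra.Properties.CommutativeMonoid.Sum as CommutativeMonoidSum
open import Data.Bool.Base using (true; false; if_then_else_; _∧_)
open import Data.Fin.Base as Fin using (Fin; zero; suc; toℕ; punchIn; punchOut)
open import Data.Fin.Permutation as Perm using (Permutation′; _⟨$⟩ʳ_; insert; insert-punchIn)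
import Data.Fin.Properties as Fin
open import Data.Fin.Subset using (Subset; _∈_; inside; outside)
open import Data.Fin.Subset.Properties using (_∈?_; drop-there)
open import Data.Integer.Base using (ℤ; 0ℤ; 1ℤ; -1ℤ; _+_; _*_; _-_; _^_)
import Data.Integer.Properties as ℤ
open import Data.Integer.Tactic.RingSolver using (solve-∀)
open import Data.List.Base
  using (List; []; _∷_; _++_; map; foldr; filter; tabulate; cartesianProductWith; cartesianProduct)
import Data.List.Properties as List
import Data.List.Relation.Unary.All as All
open import Data.Nat.Base as ℕ using (zero; suc)
import Data.Nat.Properties as ℕ
open import Data.Product.Base using (_,_; proj₁; proj₂)
open import Data.Sum.Base using (_⊎_; inj₁; inj₂; [_,_]′)
open import Data.Vec.Base using ([]; _∷_; here; there)
open import Function.Base using (_∘_; id; const)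
open import Function.Bundles using (Inverse; _⇔_; mk⇔; Equivalence)
open import Level using (Level)
open import Relation.Binary.PropositionalEquality
  using (_≢_; _≗_; refl; sym; trans; cong; cong₂; subst; module ≡-Reasoning)
open import Relation.Nullary.Decidable
  using (Dec; yes; no; does; dec-true; dec-false; does-⇔; _×-dec_; _⊎-dec_; _→-dec_)
open import Relation.Nullary.Negation using (¬_; contradiction)
open import Relation.Unary using (Pred; Decidable)

module ℕSum = CommutativeMonoidSum ℕ.+-0-commutativeMonoid
module ℤSum = CommutativeMonoidSum ℤ.+-0-commutativeMonoid
module ℤProduct = CommutativeMonoidSum ℤ.*-1-commutativeMonoid

private
  variable
    a b p q : Level
    A : Set a
    B : Set b
    n : ℕ

-- Counting with filter

module _ {P : Pred B p} (P? : Decidable P) where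

  length-filter-map : (f : A → B) (xs : List A) →
                      length (filter P? (map f xs)) ≡ length (filter (P? ∘ f) xs)
  length-filter-map f []       = refl
  length-filter-map f (x ∷ xs) with does (P? (f x))
  ... | true  = cong suc (length-filter-map f xs)
  ... | false = length-filter-map f xs

  length-filter-++ : ∀ xs ys → length (filter P? (xs ++ ys)) ≡
                     length (filter P? xs) ℕ.+ length (filter P? ys)
  length-filter-++ xs ys =
    trans (cong length (List.filter-++ P? xs ys)) (List.length-++ (filter P? xs))

  length-filter-none : (∀ x → ¬ P x) → ∀ xs → length (filter P? xs) ≡ 0
  length-filter-none ¬P xs = cong length (List.filter-none P? (All.universal ¬P xs))

  length-filter-⇔ : {Q : Pred B q} (Q? : Decidable Q) → (∀ x → P x ⇔ Q x) →
                    ∀ xs → length (filter P? xs) ≡ length (filter Q? xs)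
  length-filter-⇔ Q? eq xs = cong length (List.filter-≐ P? Q?
    ((λ {x} → Equivalence.to (eq x)) , (λ {x} → Equivalence.from (eq x))) xs)

indicator : {P : Set p} → Dec P → ℕ
indicator d = if does d then 1 else 0

length-filter-tabulate : {P : Pred A p} (P? : Decidable P) (f : Fin n → A) →
                         length (filter P? (tabulate f)) ≡ ℕSum.sum (indicator ∘ P? ∘ f)
length-filter-tabulate {n = zero}  P? f = refl
length-filter-tabulate {n = suc n} P? f with does (P? (f zero))
... | true  = cong suc (length-filter-tabulate P? (f ∘ suc))
... | false = length-filter-tabulate P? (f ∘ suc)

-- Turns the number of inversions into a double sum, which can be split at position 0 and reindexed
-- by a permutation.
length-filter-cartesianProduct :
  ∀ {m} {P : Pred (A × B) p} (P? : Decidable P) (f : Fin m → A) (g : Fin n → B) →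
  length (filter P? (cartesianProduct (tabulate f) (tabulate g))) ≡
  ℕSum.sum (λ i → ℕSum.sum (λ j → indicator (P? (f i , g j))))
length-filter-cartesianProduct {m = zero}  P? f g = refl
length-filter-cartesianProduct {m = suc m} P? f g = begin
  length (filter P? (map (f zero ,_) (tabulate g) ++ cartesianProduct (tabulate (f ∘ suc)) (tabulate g)))
    ≡⟨ length-filter-++ P? (map (f zero ,_) (tabulate g)) _ ⟩
  length (filter P? (map (f zero ,_) (tabulate g))) ℕ.+
  length (filter P? (cartesianProduct (tabulate (f ∘ suc)) (tabulate g)))
    ≡⟨ cong₂ ℕ._+_
         (trans (length-filter-map P? (f zero ,_) (tabulate g))
                (length-filter-tabulate (P? ∘ (f zero ,_)) g))
         (length-filter-cartesianProduct P? (f ∘ suc) g) ⟩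
  _ ∎
  where open ≡-Reasoning

-- Inversions

-- `punchIn j` fixes the values below `j` and moves all others above `j`. Stated for `does` so that
-- it applies inside `indicator`.
does-punchIn-<-pivot : (j : Fin (suc n)) (k : Fin n) →
                       does (punchIn j k Fin.<? j) ≡ does (k Fin.<? j)
does-punchIn-<-pivot zero    k       = refl
does-punchIn-<-pivot (suc j) zero    = refl
does-punchIn-<-pivot (suc j) (suc k) = does-punchIn-<-pivot j k

does-punchIn-< : (j : Fin (suc n)) (k l : Fin n) →
                 does (punchIn j k Fin.<? punchIn j l) ≡ does (k Fin.<? l)
does-punchIn-< zero    k       l       = refl
does-punchIn-< (suc j) zero    zero    = refl
does-punchIn-< (suc j) zero    (suc l) = refl
does-punchIn-< (suc j) (suc k) zero    = refl
does-punchIn-< (suc j) (suc k) (suc l) = does-punchIn-< j k l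

-- All `toℕ j` values below `j` occur in `Fin n`, even if `j` is the top element of `Fin (suc n)`.
count-below : (j : Fin (suc n)) → ℕSum.sum (λ (l : Fin n) → indicator (l Fin.<? j)) ≡ toℕ j
count-below {n}     zero    = ℕSum.sum-replicate-zero n
count-below {suc n} (suc j) = cong suc (count-below j)

length-inversions : (σ : Permutation′ n) → length (inversions σ) ≡
  ℕSum.sum λ i → ℕSum.sum λ j →
    indicator ((i Fin.<? j) ×-dec ((σ ⟨$⟩ʳ j) Fin.<? (σ ⟨$⟩ʳ i)))
length-inversions σ = length-filter-cartesianProduct
  (λ (i , j) → (i Fin.<? j) ×-dec ((σ ⟨$⟩ʳ j) Fin.<? (σ ⟨$⟩ʳ i))) id id

-- Position 0 is inverted with exactly those later positions whose image is below `j`; the other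
-- pairs are ordered as under `ρ`, because `punchIn j` is strictly monotone.
length-inversions-insert : (j : Fin (suc n)) (ρ : Permutation′ n) →
  length (inversions (insert zero j ρ)) ≡ toℕ j ℕ.+ length (inversions ρ)
length-inversions-insert {n} j ρ = begin
  length (inversions σ)
    ≡⟨ length-inversions σ ⟩
  ℕSum.sum (λ l → indicator ((σ ⟨$⟩ʳ suc l) Fin.<? j)) ℕ.+
  ℕSum.sum (λ k → ℕSum.sum λ l →
    indicator ((k Fin.<? l) ×-dec ((σ ⟨$⟩ʳ suc l) Fin.<? (σ ⟨$⟩ʳ suc k))))
    ≡⟨ cong₂ ℕ._+_
         -- Reindexing by `ρ` turns the images below `j` into the values below `j`.
         (trans (ℕSum.sum-cong-≗ first) (trans (sym (ℕSum.sum-permute _ ρ)) (count-below j)))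
         (trans (ℕSum.sum-cong-≗ (λ k → ℕSum.sum-cong-≗ (rest k))) (sym (length-inversions ρ))) ⟩
  toℕ j ℕ.+ length (inversions ρ) ∎
  where
  open ≡-Reasoning

  σ : Permutation′ (suc n)
  σ = insert zero j ρ

  first : ∀ l → indicator ((σ ⟨$⟩ʳ suc l) Fin.<? j) ≡ indicator ((ρ ⟨$⟩ʳ l) Fin.<? j)
  first l rewrite insert-punchIn zero j ρ l =
    cong (if_then 1 else 0) (does-punchIn-<-pivot j (ρ ⟨$⟩ʳ l))

  rest : ∀ k l →
    indicator ((k Fin.<? l) ×-dec ((σ ⟨$⟩ʳ suc l) Fin.<? (σ ⟨$⟩ʳ suc k))) ≡
    indicator ((k Fin.<? l) ×-dec ((ρ ⟨$⟩ʳ l) Fin.<? (ρ ⟨$⟩ʳ k)))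
  rest k l rewrite insert-punchIn zero j ρ l | insert-punchIn zero j ρ k =
    cong (λ d → if does (k Fin.<? l) ∧ d then 1 else 0) (does-punchIn-< j (ρ ⟨$⟩ʳ l) (ρ ⟨$⟩ʳ k))

sign-insert : (j : Fin (suc n)) (ρ : Permutation′ n) →
              sign (insert zero j ρ) ≡ -1ℤ ^ toℕ j * sign ρ
sign-insert j ρ = trans (cong (-1ℤ ^_) (length-inversions-insert j ρ))
                        (ℤ.^-distribˡ-+-* -1ℤ (toℕ j) (length (inversions ρ)))

-- Laplace expansion

sumMap : List A → (A → ℤ) → ℤ
sumMap xs f = foldr _+_ 0ℤ (map f xs)

sumMap-cong : {f g : A → ℤ} → f ≗ g → ∀ xs → sumMap xs f ≡ sumMap xs g
sumMap-cong eq xs = cong (foldr _+_ 0ℤ) (List.map-cong eq xs)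

sumMap-++ : (f : A → ℤ) (xs ys : List A) → sumMap (xs ++ ys) f ≡ sumMap xs f + sumMap ys f
sumMap-++ f []       ys = sym (ℤ.+-identityˡ _)
sumMap-++ f (x ∷ xs) ys =
  trans (cong (_+_ (f x)) (sumMap-++ f xs ys)) (sym (ℤ.+-assoc (f x) _ _))

sumMap-*ˡ : (c : ℤ) (f : A → ℤ) (xs : List A) → sumMap xs (λ x → c * f x) ≡ c * sumMap xs f
sumMap-*ˡ c f []       = sym (ℤ.*-zeroʳ c)
sumMap-*ˡ c f (x ∷ xs) =
  trans (cong (_+_ (c * f x)) (sumMap-*ˡ c f xs)) (sym (ℤ.*-distribˡ-+ c (f x) _))

-- Applied to `permutations (suc n)`, this groups the permutations by the image of 0.
sumMap-cartesianProductWith :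
  ∀ {c m} {C : Set c} (h : A → B → C) (f : C → ℤ) (g : Fin m → A) (ys : List B) →
  sumMap (cartesianProductWith h (tabulate g) ys) f ≡ sum (λ i → sumMap ys (f ∘ h (g i)))
sumMap-cartesianProductWith {m = zero}  h f g ys = refl
sumMap-cartesianProductWith {m = suc m} h f g ys =
  trans (sumMap-++ f (map (h (g zero)) ys) _)
        (cong₂ _+_ (cong (foldr _+_ 0ℤ) (sym (List.map-∘ ys)))
                   (sumMap-cartesianProductWith h f (g ∘ suc) ys))

minor : Matrix (suc n) → Fin (suc n) → Matrix n
minor M j i k = M (suc i) (punchIn j k)

-- ε = 1 gives the permanent and ε = -1 the determinant.
laplace : ℤ → Matrix n → ℤ
laplace {zero}  ε M = 1ℤ
laplace {suc n} ε M = ∑[ j < suc n ] (ε ^ toℕ j * (M zero j * laplace ε (minor M j)))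

module _ (ε : ℤ) (w : ∀ {n} → Permutation′ n → ℤ)
         (w-id : w {zero} Perm.id ≡ 1ℤ)
         (w-insert : ∀ {n} (j : Fin (suc n)) (ρ : Permutation′ n) →
                     w (insert zero j ρ) ≡ ε ^ toℕ j * w ρ) where

  -- For a fixed image `j` of 0, the remaining `ρ` runs through the permutations that expand
  -- `minor M j`, since `insert zero j ρ` sends `suc i` to `punchIn j` of the image of `i`. The
  -- cofactor sign comes from `w-insert`.
  laplace-expansion : (M : Matrix n) →
    sumPermutations n (λ σ → w σ * product (λ i → M i (σ ⟨$⟩ʳ i))) ≡ laplace ε M
  laplace-expansion {zero}  M = cong (λ x → x * 1ℤ + 0ℤ) w-id
  laplace-expansion {suc n} M = begin
    sumPermutations (suc n) (λ σ → w σ * product (λ i → M i (σ ⟨$⟩ʳ i)))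
      ≡⟨ sumMap-cartesianProductWith (insert zero) _ id (permutations n) ⟩
    ∑[ j < suc n ] sumMap (permutations n)
      (λ ρ → w (insert zero j ρ) * (M zero j * product (λ i → M (suc i) (insert zero j ρ ⟨$⟩ʳ suc i))))
      ≡⟨ sum-cong-≗ (λ j → trans (sumMap-cong (term j) (permutations n))
                                 (sumMap-*ˡ (ε ^ toℕ j * M zero j) _ (permutations n))) ⟩
    ∑[ j < suc n ] (ε ^ toℕ j * M zero j *
      sumPermutations n (λ ρ → w ρ * product (λ i → minor M j i (ρ ⟨$⟩ʳ i))))
      ≡⟨ sum-cong-≗ (λ j → trans (cong (ε ^ toℕ j * M zero j *_) (laplace-expansion (minor M j)))
                                 (ℤ.*-assoc (ε ^ toℕ j) (M zero j) _)) ⟩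
    laplace ε M ∎
    where
    open ≡-Reasoning

    rearrange : ∀ e x y z → e * x * (y * z) ≡ e * y * (x * z)
    rearrange = solve-∀

    term : ∀ j ρ →
      w (insert zero j ρ) * (M zero j * product (λ i → M (suc i) (insert zero j ρ ⟨$⟩ʳ suc i))) ≡
      ε ^ toℕ j * M zero j * (w ρ * product (λ i → minor M j i (ρ ⟨$⟩ʳ i)))
    term j ρ = trans
      (cong₂ (λ x y → x * (M zero j * y)) (w-insert j ρ)
        (ℤProduct.sum-cong-≗ (λ i → cong (M (suc i)) (insert-punchIn zero j ρ i))))
      (rearrange (ε ^ toℕ j) (w ρ) (M zero j) _)

per-laplace : (M : Matrix n) → per M ≡ laplace 1ℤ M
per-laplace {n} M = trans
  (sumMap-cong (λ σ → sym (ℤ.*-identityˡ _)) (permutations n))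
  (laplace-expansion 1ℤ (const 1ℤ) refl
    (λ j ρ → sym (trans (ℤ.*-identityʳ (1ℤ ^ toℕ j)) (ℤ.^-zeroˡ (toℕ j)))) M)

det-laplace : (M : Matrix n) → det M ≡ laplace -1ℤ M
det-laplace = laplace-expansion -1ℤ sign refl sign-insert

module _ (ε : ℤ) where

  laplace-cong : (M N : Matrix n) → (∀ i j → M i j ≡ N i j) → laplace ε M ≡ laplace ε N
  laplace-cong {zero}  M N eq = refl
  laplace-cong {suc n} M N eq = sum-cong-≗ λ j →
    cong₂ (λ x y → ε ^ toℕ j * (x * y)) (eq zero j)
          (laplace-cong (minor M j) (minor N j) (λ i k → eq (suc i) (punchIn j k)))

  -- Mutual induction with `laplace-column`, which is used here at the same size and calls back only
  -- on minors. Only expansion along the first row is available, so both hold for every `ε`.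
  laplace-zeroColumn : (M : Matrix n) (p : Fin n) → (∀ i → M i p ≡ 0ℤ) → laplace ε M ≡ 0ℤ

  -- For `j ≢ p` the minor still contains column `p` without its top entry, hence a zero column;
  -- only the term at `p` survives.
  laplace-column : (M : Matrix (suc n)) (p : Fin (suc n)) → (∀ i → M (suc i) p ≡ 0ℤ) →
                   laplace ε M ≡ ε ^ toℕ p * (M zero p * laplace ε (minor M p))

  laplace-zeroColumn {suc n} M p eq = begin
    laplace ε M                                       ≡⟨ laplace-column M p (eq ∘ suc) ⟩
    ε ^ toℕ p * (M zero p * laplace ε (minor M p))
      ≡⟨ cong (λ x → ε ^ toℕ p * (x * laplace ε (minor M p))) (eq zero) ⟩
    ε ^ toℕ p * (0ℤ * laplace ε (minor M p))          ≡⟨ ℤ.*-zeroʳ (ε ^ toℕ p) ⟩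
    0ℤ                                                ∎
    where open ≡-Reasoning

  laplace-column {n} M p eq = begin
    sum term                                          ≡⟨ ℤSum.sum-remove {i = p} term ⟩
    term p + sum (term ∘ punchIn p)                   ≡⟨ cong (_+_ (term p)) others ⟩
    term p + 0ℤ                                       ≡⟨ ℤ.+-identityʳ (term p) ⟩
    term p                                            ∎
    where
    open ≡-Reasoning

    term : Fin (suc n) → ℤ
    term j = ε ^ toℕ j * (M zero j * laplace ε (minor M j))

    minor-zero : ∀ j → j ≢ p → laplace ε (minor M j) ≡ 0ℤ
    minor-zero j j≢p = laplace-zeroColumn (minor M j) (punchOut j≢p) λ i →
      trans (cong (M (suc i)) (Fin.punchIn-punchOut j≢p)) (eq i)

    term-zero : ∀ j → j ≢ p → term j ≡ 0ℤ
    term-zero j j≢p = begin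
      term j                         ≡⟨ cong (λ x → ε ^ toℕ j * (M zero j * x)) (minor-zero j j≢p) ⟩
      ε ^ toℕ j * (M zero j * 0ℤ)    ≡⟨ cong (ε ^ toℕ j *_) (ℤ.*-zeroʳ (M zero j)) ⟩
      ε ^ toℕ j * 0ℤ                 ≡⟨ ℤ.*-zeroʳ (ε ^ toℕ j) ⟩
      0ℤ                             ∎

    others : sum (term ∘ punchIn p) ≡ 0ℤ
    others = trans (sum-cong-≗ λ k → term-zero (punchIn p k) (Fin.punchInᵢ≢i p k))
                   (sum-replicate-zero n)

-- Bordered matrices

border : (Fin n → ℤ) → Matrix n → Matrix (suc n)
border r Z i       zero    = 1ℤ
border r Z zero    (suc j) = r j
border r Z (suc i) (suc j) = Z i j

submatrix : Matrix (suc n) → Matrix n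
submatrix Z i j = Z (suc i) (suc j)

-- After the top row is deleted, the column at index 1 is the first column of `Z`, whose only
-- nonzero entry is the 1 on top. Expanding there costs one factor `ε`.
laplace-minor-border : (ε : ℤ) (r : Fin (suc n) → ℤ) (Z : Matrix (suc n)) →
  Z zero zero ≡ 1ℤ → (∀ i → Z (suc i) zero ≡ 0ℤ) → ∀ k →
  laplace ε (minor (border r Z) (suc (suc k))) ≡
  ε * laplace ε (minor (border (r ∘ suc) (submatrix Z)) (suc k))
laplace-minor-border {suc n} ε r Z Z₀₀ Zᵢ₀ k = begin
  laplace ε M
    ≡⟨ laplace-column ε M (suc zero) Zᵢ₀ ⟩
  ε ^ 1 * (Z zero zero * laplace ε (minor M (suc zero)))
    ≡⟨ cong₂ _*_ (ℤ.^-identityʳ ε) (cong₂ _*_ Z₀₀ (laplace-cong ε (minor M (suc zero)) N λ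
         { i zero → refl ; i (suc l) → refl })) ⟩
  ε * (1ℤ * laplace ε N)
    ≡⟨ cong (ε *_) (ℤ.*-identityˡ _) ⟩
  ε * laplace ε N ∎
  where
  open ≡-Reasoning

  M : Matrix (suc (suc n))
  M = minor (border r Z) (suc (suc k))

  N : Matrix (suc n)
  N = minor (border (r ∘ suc) (submatrix Z)) (suc k)

-- Expand along the second column, whose only nonzero entries are r zero and
-- Z zero zero = 1.
laplace-border : (ε : ℤ) → ε * ε ≡ 1ℤ → (r : Fin (suc n) → ℤ) (Z : Matrix (suc n)) →
  Z zero zero ≡ 1ℤ → (∀ i → Z (suc i) zero ≡ 0ℤ) →
  laplace ε (border r Z) ≡
  ε * (r zero * laplace ε (border (Z zero ∘ suc) (submatrix Z))) +
  laplace ε (border (r ∘ suc) (submatrix Z))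
laplace-border {n} ε ε² r Z Z₀₀ Zᵢ₀ = begin
  1ℤ * (1ℤ * laplace ε Z) + (ε ^ 1 * (r zero * laplace ε (minor M (suc zero))) +
    ∑[ k < n ] (ε ^ toℕ (suc (suc k)) * (r (suc k) * laplace ε (minor M (suc (suc k))))))
    ≡⟨ cong₂ (λ x y → 1ℤ * (1ℤ * x) + y) first (cong₂ _+_ second (sum-cong-≗ term)) ⟩
  1ℤ * (1ℤ * x) + (ε * (r zero * y) + s)
    -- `x` is also the value of the leading minor of `N`, so `1ℤ * (1ℤ * x) + s` is the expansion of
    -- `laplace ε N`.
    ≡⟨ rearrange x (ε * (r zero * y)) s ⟩
  ε * (r zero * y) + (1ℤ * (1ℤ * x) + s) ∎
  where
  open ≡-Reasoning

  M : Matrix (suc (suc n))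
  M = border r Z

  Z′ : Matrix n
  Z′ = submatrix Z

  N : Matrix (suc n)
  N = border (r ∘ suc) Z′

  x y s : ℤ
  x = laplace ε Z′
  y = laplace ε (border (Z zero ∘ suc) Z′)
  s = ∑[ k < n ] (ε ^ toℕ (suc k) * (r (suc k) * laplace ε (minor N (suc k))))

  rearrange : ∀ x y z → 1ℤ * (1ℤ * x) + (y + z) ≡ y + (1ℤ * (1ℤ * x) + z)
  rearrange = solve-∀

  first : laplace ε Z ≡ x
  first = begin
    laplace ε Z              ≡⟨ laplace-column ε Z zero Zᵢ₀ ⟩
    1ℤ * (Z zero zero * x)   ≡⟨ cong (λ z → 1ℤ * (z * x)) Z₀₀ ⟩
    1ℤ * (1ℤ * x)            ≡⟨ trans (ℤ.*-identityˡ (1ℤ * x)) (ℤ.*-identityˡ x) ⟩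
    x                        ∎

  second : ε ^ 1 * (r zero * laplace ε (minor M (suc zero))) ≡ ε * (r zero * y)
  second = cong₂ (λ e z → e * (r zero * z)) (ℤ.^-identityʳ ε)
    (laplace-cong ε (minor M (suc zero)) (border (Z zero ∘ suc) Z′) λ
    { i       zero    → refl
    ; zero    (suc k) → refl
    ; (suc i) (suc k) → refl })

  ε²-cancel : ∀ e a b → ε * e * (a * (ε * b)) ≡ e * (a * b)
  ε²-cancel e a b = begin
    ε * e * (a * (ε * b))    ≡⟨ regroup ε e a b ⟩
    ε * ε * (e * (a * b))    ≡⟨ cong (_* (e * (a * b))) ε² ⟩
    1ℤ * (e * (a * b))       ≡⟨ ℤ.*-identityˡ _ ⟩
    e * (a * b)              ∎
    where
    regroup : ∀ ε e a b → ε * e * (a * (ε * b)) ≡ ε * ε * (e * (a * b))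
    regroup = solve-∀

  term : ∀ k →
    ε ^ toℕ (suc (suc k)) * (r (suc k) * laplace ε (minor M (suc (suc k)))) ≡
    ε ^ toℕ (suc k) * (r (suc k) * laplace ε (minor N (suc k)))
  -- One `ε` comes from the column index, which is one larger than in `N`, the other from
  -- `laplace-minor-border`; they cancel.
  term k = trans
    (cong (λ z → ε ^ toℕ (suc (suc k)) * (r (suc k) * z)) (laplace-minor-border ε r Z Z₀₀ Zᵢ₀ k))
    (ε²-cancel (ε ^ toℕ (suc k)) (r (suc k)) (laplace ε (minor N (suc k))))

-- Lets the equations `Z b = 1` pass to `submatrix Z` and the tail of `b` in the induction.
sum-lower-row : (Z : Matrix (suc n)) → UpperTriangular Z → (b : Fin (suc n) → ℤ) → ∀ i →
  ∑[ k < n ] (submatrix Z i k * b (suc k)) ≡ ∑[ k < suc n ] (Z (suc i) k * b k)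
sum-lower-row {n} Z ut b i = begin
  s                              ≡⟨ ℤ.+-identityˡ s ⟨
  0ℤ * b zero + s                ≡⟨ cong (λ d → d * b zero + s) (ut ℕ.z<s) ⟨
  Z (suc i) zero * b zero + s    ∎
  where
  open ≡-Reasoning

  s : ℤ
  s = ∑[ k < n ] (submatrix Z i k * b (suc k))

-- The Schur complement formula for a block `Z` of determinant 1. Taking any solution `b` of
-- `Z b = 1` keeps inverse matrices out of the induction.
laplace-border-solution : (r : Fin n → ℤ) (Z : Matrix n) →
  UpperTriangular Z → (∀ i → Z i i ≡ 1ℤ) →
  (b : Fin n → ℤ) → (∀ i → ∑[ k < n ] (Z i k * b k) ≡ 1ℤ) →
  laplace -1ℤ (border r Z) ≡ 1ℤ - ∑[ k < n ] (r k * b k)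

-- The border is the first row of `Z` past the diagonal, and the first equation of `Z b = 1` says
-- that `1ℤ - t` is `b zero`.
laplace-border-head : (Z : Matrix (suc n)) →
  UpperTriangular Z → (∀ i → Z i i ≡ 1ℤ) →
  (b : Fin (suc n) → ℤ) → (∀ i → ∑[ k < suc n ] (Z i k * b k) ≡ 1ℤ) →
  laplace -1ℤ (border (Z zero ∘ suc) (submatrix Z)) ≡ b zero

laplace-border-solution {zero}  r Z ut diag b Zb = refl
laplace-border-solution {suc n} r Z ut diag b Zb = begin
  laplace -1ℤ (border r Z)
    ≡⟨ laplace-border -1ℤ refl r Z (diag zero) (λ i → ut ℕ.z<s) ⟩
  -1ℤ * (r zero * laplace -1ℤ (border (Z zero ∘ suc) (submatrix Z))) +
  laplace -1ℤ (border (r ∘ suc) (submatrix Z))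
    ≡⟨ cong₂ (λ x y → -1ℤ * (r zero * x) + y)
         (laplace-border-head Z ut diag b Zb)
         (laplace-border-solution (r ∘ suc) (submatrix Z) (ut ∘ ℕ.s<s) (diag ∘ suc) (b ∘ suc)
           (λ i → trans (sum-lower-row Z ut b i) (Zb (suc i)))) ⟩
  -1ℤ * (r zero * b zero) + (1ℤ - t)
    ≡⟨ simplify (r zero * b zero) t ⟩
  1ℤ - (r zero * b zero + t) ∎
  where
  open ≡-Reasoning

  t : ℤ
  t = ∑[ k < n ] (r (suc k) * b (suc k))

  simplify : ∀ x t → -1ℤ * x + (1ℤ - t) ≡ 1ℤ - (x + t)
  simplify = solve-∀

laplace-border-head {n} Z ut diag b Zb = begin
  laplace -1ℤ (border (Z zero ∘ suc) (submatrix Z))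
    ≡⟨ laplace-border-solution (Z zero ∘ suc) (submatrix Z) (ut ∘ ℕ.s<s) (diag ∘ suc) (b ∘ suc)
         (λ i → trans (sum-lower-row Z ut b i) (Zb (suc i))) ⟩
  1ℤ - t
    ≡⟨ cong (_- t) (Zb zero) ⟨
  Z zero zero * b zero + t - t
    ≡⟨ cong (λ d → d * b zero + t - t) (diag zero) ⟩
  1ℤ * b zero + t - t
    ≡⟨ simplify (b zero) t ⟩
  b zero ∎
  where
  open ≡-Reasoning

  t : ℤ
  t = ∑[ k < n ] (Z zero (suc k) * b (suc k))

  simplify : ∀ x t → 1ℤ * x + t - t ≡ x
  simplify = solve-∀

sum-Id-row : (i : Fin n) → ∑[ j < n ] Id i j ≡ 1ℤ
sum-Id-row {suc n} zero    = cong (_+_ 1ℤ) (sum-replicate-zero n)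
sum-Id-row {suc n} (suc i) = trans (ℤ.+-identityˡ _) (sum-Id-row i)

-- Both sides of `M X = Id` are applied to the all-ones vector. This supplies the solution `b` for
-- `laplace-border-head`.
rightInverse-rowSums : (M X : Matrix n) → (∀ i j → (M ⊗ X) i j ≡ Id i j) →
  ∀ i → ∑[ k < n ] (M i k * ∑[ j < n ] X k j) ≡ 1ℤ
rightInverse-rowSums {n} M X MX i = begin
  ∑[ k < n ] (M i k * ∑[ j < n ] X k j)     ≡⟨ sum-cong-≗ (λ k → *-distribˡ-sum (M i k) (X k)) ⟩
  ∑[ k < n ] ∑[ j < n ] (M i k * X k j)     ≡⟨ ∑-comm (λ k j → M i k * X k j) ⟩
  ∑[ j < n ] (M ⊗ X) i j                    ≡⟨ sum-cong-≗ (MX i) ⟩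
  ∑[ j < n ] Id i j                         ≡⟨ sum-Id-row i ⟩
  1ℤ                                        ∎
  where open ≡-Reasoning

-- Chains

length-filter-subsets : {P : Pred (Subset (suc n)) p} (P? : Decidable P) →
  length (filter P? (subsets (suc n))) ≡
  length (filter (P? ∘ (inside ∷_)) (subsets n)) ℕ.+ length (filter (P? ∘ (outside ∷_)) (subsets n))
length-filter-subsets {n} P? = trans
  (length-filter-++ P? (map (inside ∷_) (subsets n)) (map (outside ∷_) (subsets n)))
  (cong₂ ℕ._+_ (length-filter-map P? (inside ∷_) (subsets n))
               (length-filter-map P? (outside ∷_) (subsets n)))

𝟙-true : {P : Set p} (d : Dec P) → P → 𝟙 d ≡ 1ℤ
𝟙-true d x = cong (if_then 1ℤ else 0ℤ) (dec-true d x)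

𝟙-⇔ : {P : Set p} {Q : Set q} → P ⇔ Q → (d : Dec P) (e : Dec Q) → 𝟙 d ≡ 𝟙 e
𝟙-⇔ eq d e = cong (if_then 1ℤ else 0ℤ) (does-⇔ eq d e)

𝟙≡0⇒¬ : {P : Set p} (d : Dec P) → 𝟙 d ≡ 0ℤ → ¬ P
𝟙≡0⇒¬ d eq x with () ← trans (sym (𝟙-true d x)) eq

module _ {c ℓ₁ ℓ₂} (S : DecPoset c ℓ₁ ℓ₂) where

  private
    module S = DecPoset S

  open DecPoset S using (Carrier; _≤_; _≤?_)

  -- Upper-triangularity of ζ in terms of the order. It is stated for families rather than
  -- labellings because the induction passes to `e ∘ suc`, which misses an element.
  LinearExtension : (Fin n → Carrier) → Set _
  LinearExtension e = ∀ {i j} → j Fin.< i → ¬ e i ≤ e j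

  Chain : (Fin n → Carrier) → Subset n → Set _
  Chain e C = ∀ i j → i ∈ C → j ∈ C → e i ≤ e j ⊎ e j ≤ e i

  -- `x` is kept outside the enumeration: adjoining it to `C` gives a chain with least element `x`.
  ChainAbove : Carrier → (Fin n → Carrier) → Subset n → Set _
  ChainAbove x e C = (∀ i → i ∈ C → x ≤ e i) × Chain e C

  chainAbove? : ∀ x (e : Fin n → Carrier) → Decidable (ChainAbove x e)
  chainAbove? x e C = Fin.all? (λ i → (i ∈? C) →-dec (x ≤? e i)) ×-dec
    Fin.all? λ i → Fin.all? λ j →
      (i ∈? C) →-dec ((j ∈? C) →-dec ((e i ≤? e j) ⊎-dec (e j ≤? e i)))

  module _ (e : Fin (suc n) → Carrier) (C : Subset n) where

    -- No later element lies below `e zero`, so being comparable with `e zero` means being above it.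
    chain-inside : LinearExtension e → Chain e (inside ∷ C) ⇔ ChainAbove (e zero) (e ∘ suc) C
    chain-inside linear = mk⇔
      (λ chain →
        (λ i i∈C → [ id , (λ le → contradiction le (linear ℕ.z<s)) ]′
                     (chain zero (suc i) here (there i∈C))) ,
        (λ i j i∈C j∈C → chain (suc i) (suc j) (there i∈C) (there j∈C)))
      (λ (above , chain) → λ where
        zero    zero    _   _   → inj₁ S.refl
        zero    (suc j) _   j∈C → inj₁ (above j (drop-there j∈C))
        (suc i) zero    i∈C _   → inj₂ (above i (drop-there i∈C))
        (suc i) (suc j) i∈C j∈C → chain i j (drop-there i∈C) (drop-there j∈C))

    chainAbove-inside : LinearExtension e → ∀ {x} → x ≤ e zero →
      ChainAbove x e (inside ∷ C) ⇔ ChainAbove (e zero) (e ∘ suc) C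
    chainAbove-inside linear x≤e₀ = mk⇔
      (λ (_ , chain) → Equivalence.to (chain-inside linear) chain)
      (λ (above , chain) →
        (λ { zero    _   → x≤e₀
           ; (suc i) i∈C → S.trans x≤e₀ (above i (drop-there i∈C)) }) ,
        Equivalence.from (chain-inside linear) (above , chain))

    chainAbove-outside : ∀ {x} → ChainAbove x e (outside ∷ C) ⇔ ChainAbove x (e ∘ suc) C
    chainAbove-outside = mk⇔
      (λ (above , chain) →
        (λ i i∈C → above (suc i) (there i∈C)) ,
        (λ i j i∈C j∈C → chain (suc i) (suc j) (there i∈C) (there j∈C)))
      (λ (above , chain) →
        (λ { (suc i) (there i∈C) → above i i∈C }) ,
        (λ { (suc i) (suc j) (there i∈C) (there j∈C) → chain i j i∈C j∈C }))

  chainsAbove : Carrier → (Fin n → Carrier) → List (Subset n)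
  chainsAbove {n} x e = filter (chainAbove? x e) (subsets n)

  -- Induction with `x` arbitrary: in `laplace-border` the chains through `e zero` give the term
  -- where `e zero` takes the place of `x`, the others the term where `x` stays.
  laplace-chainsAbove : (x : Carrier) (e : Fin n → Carrier) → LinearExtension e →
    laplace 1ℤ (border (λ k → 𝟙 (x ≤? e k)) (λ i j → 𝟙 (e i ≤? e j))) ≡
    + length (chainsAbove x e)
  -- The matrix is the single entry 1, and the empty set is the one chain to count.
  laplace-chainsAbove {zero}  x e linear = sym (cong (λ Cs → + length Cs)
    (List.filter-accept (chainAbove? x e) {x = []} {xs = []} ((λ ()) , λ ())))
  laplace-chainsAbove {suc n} x e linear = begin
    laplace 1ℤ (border (λ k → 𝟙 (x ≤? e k)) (λ i j → 𝟙 (e i ≤? e j)))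
      ≡⟨ laplace-border 1ℤ refl (λ k → 𝟙 (x ≤? e k)) (λ i j → 𝟙 (e i ≤? e j))
           (𝟙-true (e zero ≤? e zero) S.refl)
           (λ i → cong (if_then 1ℤ else 0ℤ) (dec-false (e (suc i) ≤? e zero) (linear ℕ.z<s))) ⟩
    1ℤ * (𝟙 (x ≤? e zero) *
      laplace 1ℤ (border (λ k → 𝟙 (e zero ≤? e (suc k))) (λ i j → 𝟙 (e (suc i) ≤? e (suc j))))) +
    laplace 1ℤ (border (λ k → 𝟙 (x ≤? e (suc k))) (λ i j → 𝟙 (e (suc i) ≤? e (suc j))))
      ≡⟨ cong₂ (λ y z → 1ℤ * (𝟙 (x ≤? e zero) * y) + z)
           (laplace-chainsAbove (e zero) (e ∘ suc) (linear ∘ ℕ.s<s))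
           (laplace-chainsAbove x (e ∘ suc) (linear ∘ ℕ.s<s)) ⟩
    1ℤ * (𝟙 (x ≤? e zero) * + length (chainsAbove (e zero) (e ∘ suc))) +
    + length (chainsAbove x (e ∘ suc))
      ≡⟨ cong₂ _+_
           (trans (ℤ.*-identityˡ _) (head∈ (x ≤? e zero)))
           (sym (cong +_ (length-filter-⇔ (chainAbove? x e ∘ (outside ∷_)) (chainAbove? x (e ∘ suc))
             (λ C → chainAbove-outside e C) (subsets n)))) ⟩
    + (length (filter (chainAbove? x e ∘ (inside ∷_)) (subsets n)) ℕ.+
       length (filter (chainAbove? x e ∘ (outside ∷_)) (subsets n)))
      ≡⟨ cong +_ (length-filter-subsets (chainAbove? x e)) ⟨
    + length (chainsAbove x e) ∎
    where
    open ≡-Reasoning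

    -- The entry `𝟙 d` removes the first term exactly when `e zero` is not above `x`, and then no
    -- chain above `x` contains it.
    head∈ : (d : Dec (x ≤ e zero)) → 𝟙 d * + length (chainsAbove (e zero) (e ∘ suc)) ≡
            + length (filter (chainAbove? x e ∘ (inside ∷_)) (subsets n))
    head∈ (yes x≤e₀) = trans (ℤ.*-identityˡ _) (sym (cong +_
      (length-filter-⇔ (chainAbove? x e ∘ (inside ∷_)) (chainAbove? (e zero) (e ∘ suc))
        (λ C → chainAbove-inside e C linear x≤e₀) (subsets n))))
    head∈ (no  x≰e₀) = sym (cong +_
      (length-filter-none (chainAbove? x e ∘ (inside ∷_)) (λ C (above , _) → x≰e₀ (above zero here)) (subsets n)))

-- The Redheffer matrix of a labelled poset

module _ {c ℓ₁ ℓ₂} (S : DecPoset c ℓ₁ ℓ₂) (0# : DecPoset.Carrier S) (min : Minimum (DecPoset._≤_ S) 0#)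
         where

  private
    module S = DecPoset S

  module _ (L : Labelling S (suc n)) (ut : UpperTriangular (ζ S L)) where

    private
      e : Fin (suc n) → S.Carrier
      e = element S L

      Z : Matrix (suc n)
      Z = ζ S L

    linear : LinearExtension S e
    linear {i} {j} j<i = 𝟙≡0⇒¬ (e i S.≤? e j) (ut j<i)

    element-label-0# : e (label S L 0#) S.≈ 0#
    element-label-0# = Inverse.strictlyInverseˡ L 0#

    -- A later label would place `0#` after `e zero` although `0#` lies below it, against `linear`.
    label-0# : label S L 0# ≡ zero
    label-0# with label S L 0# | element-label-0#
    ... | zero  | _  = refl
    ... | suc i | eq = contradiction (S.trans (S.reflexive eq) (min (e zero))) (linear ℕ.z<s)

    element-zero : e zero S.≈ 0#
    element-zero = subst (λ i → e i S.≈ 0#) label-0# element-label-0#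

    element-suc : ∀ j → ¬ e (suc j) S.≈ 0#
    element-suc j eq = linear ℕ.z<s (S.reflexive (S.Eq.trans eq (S.Eq.sym element-zero)))

    -- The clause for `0#` makes column `zero` all ones; in the other columns it fails by
    -- `element-suc`, leaving the ζ entries.
    Redheffer-border : ∀ i j → Redheffer S L 0# i j ≡ border (Z zero ∘ suc) (submatrix Z) i j
    Redheffer-border i       zero    =
      𝟙-true ((e i S.≤? e zero) ⊎-dec (e zero S.≟ 0#)) (inj₂ element-zero)
    Redheffer-border i       (suc j) = trans
      (𝟙-⇔ (mk⇔ [ id , (λ eq → contradiction eq (element-suc j)) ]′ inj₁)
           ((e i S.≤? e (suc j)) ⊎-dec (e (suc j) S.≟ 0#)) (e i S.≤? e (suc j)))
      (border-suc i)
      where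
      border-suc : ∀ i → Z i (suc j) ≡ border (Z zero ∘ suc) (submatrix Z) i (suc j)
      border-suc zero    = refl
      border-suc (suc i) = refl

    rowSum : Fin (suc n) → ℤ
    rowSum i = ∑[ j < suc n ] ζ⁻¹ S L ut i j

    det-Redheffer : det (Redheffer S L 0#) ≡ ∑S S L (μ S L ut 0#)
    det-Redheffer = begin
      det (Redheffer S L 0#)
        ≡⟨ det-laplace (Redheffer S L 0#) ⟩
      laplace -1ℤ (Redheffer S L 0#)
        ≡⟨ laplace-cong -1ℤ (Redheffer S L 0#) _ Redheffer-border ⟩
      laplace -1ℤ (border (Z zero ∘ suc) (submatrix Z))
        ≡⟨ laplace-border-head Z ut (ζ-diagonal S L) rowSum (rightInverse-rowSums Z (ζ⁻¹ S L ut)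
             (proj₁ (proj₂ (unitriangular⇒invertible Z ut (ζ-diagonal S L))))) ⟩
      rowSum zero
        -- `μ` reads its entries through `label`, so `zero` becomes the label of `0#` and `i` the
        -- label of `element i`.
        ≡⟨ sum-cong-≗ (λ i → cong₂ (ζ⁻¹ S L ut) (sym label-0#) (sym (Inverse.strictlyInverseʳ L i))) ⟩
      ∑S S L (μ S L ut 0#) ∎
      where open ≡-Reasoning

    per-Redheffer : per (Redheffer S L 0#) ≡ + length (chainsContaining S L 0#)
    per-Redheffer = begin
      per (Redheffer S L 0#)
        ≡⟨ per-laplace (Redheffer S L 0#) ⟩
      laplace 1ℤ (Redheffer S L 0#)
        ≡⟨ laplace-cong 1ℤ (Redheffer S L 0#) _ Redheffer-border ⟩
      laplace 1ℤ (border (Z zero ∘ suc) (submatrix Z))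
        ≡⟨ laplace-chainsAbove S (e zero) (e ∘ suc) (linear ∘ ℕ.s<s) ⟩
      + length (chainsAbove S (e zero) (e ∘ suc))
        -- The added 0 will count the subsets without label `zero`, none of which contains `0#`.
        ≡⟨ cong +_ (ℕ.+-identityʳ _) ⟨
      + (length (chainsAbove S (e zero) (e ∘ suc)) ℕ.+ 0)
        ≡⟨ cong₂ (λ k l → + (k ℕ.+ l))
             (length-filter-⇔ (chainAbove? S (e zero) (e ∘ suc)) (contains? ∘ (inside ∷_))
               inside-⇔ (subsets n))
             (sym (length-filter-none (contains? ∘ (outside ∷_)) outside-∉ (subsets n))) ⟩
      + (length (filter (contains? ∘ (inside ∷_)) (subsets n)) ℕ.+
         length (filter (contains? ∘ (outside ∷_)) (subsets n)))
        ≡⟨ cong +_ (length-filter-subsets contains?) ⟨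
      + length (chainsContaining S L 0#) ∎
      where
      open ≡-Reasoning

      contains? : Decidable (λ C → IsChain S L C × label S L 0# ∈ C)
      contains? C = isChain? S L C ×-dec (label S L 0# ∈? C)

      inside-⇔ : ∀ C → ChainAbove S (e zero) (e ∘ suc) C ⇔
                       (IsChain S L (inside ∷ C) × label S L 0# ∈ inside ∷ C)
      inside-⇔ C = mk⇔
        (λ chain → Equivalence.from (chain-inside S e C linear) chain ,
                   subst (_∈ inside ∷ C) (sym label-0#) here)
        (λ (chain , _) → Equivalence.to (chain-inside S e C linear) chain)

      outside-∉ : ∀ C → ¬ (IsChain S L (outside ∷ C) × label S L 0# ∈ outside ∷ C)
      outside-∉ C (_ , 0∈C) with () ← subst (_∈ outside ∷ C) label-0# 0∈C

theorem2 : ∀ {c ℓ₁ ℓ₂} (S : DecPoset c ℓ₁ ℓ₂)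
    (0# : DecPoset.Carrier S) → Minimum (DecPoset._≤_ S) 0# →
    {n : ℕ} (L : Labelling S n) (ut : UpperTriangular (ζ S L)) →
    (per (Redheffer S L 0#) ≡ + length (chainsContaining S L 0#))
    × (det (Redheffer S L 0#) ≡ ∑S S L (λ x → μ S L ut 0# x))
-- A poset with a least element is nonempty: the label of `0#` would lie in `Fin zero`.
theorem2 S 0# min {zero}  L ut with () ← label S L 0#
theorem2 S 0# min {suc n} L ut = per-Redheffer S 0# min L ut , det-Redheffer S 0# min L ut
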